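{- The following are equivalent: (1) $\mathsf{WKL}$; (2) $\mathsf{LLPO} \land \overline{\mathcal{S}}\text{ - }\mathsf{AC}_{\mathbb{N},\mathbb{B}}$; (3) for all co-semi-decidable $R : \mathbb{N} \to \mathbb{B} \to \mathbb{P}$: $(\forall n.\ \neg\neg\exists b.\ R\,n\,b) \to \exists f : \mathbb{N} \to \mathbb{B}.\ \forall n.\ R\,n\,(f\,n)$; (4) for all co-semi-decidable $R : \mathbb{L}\,\mathbb{B} \to \mathbb{B} \to \mathbb{P}$: $(\forall u.\ \neg\neg\exists b.\ R\,u\,b) \to \exists f : \mathbb{N} \to \mathbb{B}.\ \forall n.\ R\,[f\,0, \dots, f\,(n-1)]\,(f\,n)$.
   Context: Ambient theory: Coq's type theory (constructive, with a hierarchy of types $\mathbb{T}$ and a separate impredicative universe $\mathbb{P}$ of propositions), with no additional axioms (in particular no choice axioms and no excluded middle). $\exists$ is propositional existence (eliminable in general only into propositions), $\mathbb{B}$ is the type of booleans, $\mathbb{L}\,\mathbb{B}$ the type of finite lists of booleans. For $n=0$ the list $[f\,0, \dots, f\,(n-1)]$ is empty. A predicate $p : X \to \mathbb{P}$ is co-semi-decidable, $\overline{\mathcal{S}}\,p$, if $\exists f : X \to \mathbb{N} \to \mathbb{B}.\ \forall x.\ p\,x \leftrightarrow \forall n.\ f\,x\,n = \mathsf{false}$; this is applied to binary relations by uncurrying. $\mathsf{LLPO} := \forall f\,g : \mathbb{N} \to \mathbb{B}.\ ((\exists n.\ f\,n = \mathsf{true}) \to (\exists n.\ g\,n = \mathsf{true}))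 \lor ((\exists n.\ g\,n = \mathsf{true}) \to (\exists n.\ f\,n = \mathsf{true}))$. $\overline{\mathcal{S}}\text{ - }\mathsf{AC}_{\mathbb{N},\mathbb{B}}$ := for all co-semi-decidable $R : \mathbb{N} \to \mathbb{B} \to \mathbb{P}$, $(\forall n.\,\exists b.\ R\,n\,b) \to \exists f : \mathbb{N} \to \mathbb{B}.\ \forall n.\ R\,n\,(f\,n)$. A predicate $\tau : \mathbb{L}\,\mathbb{B} \to \mathbb{P}$ is a (decidable) binary tree if (a) $\exists f : \mathbb{L}\,\mathbb{B} \to \mathbb{B}.\ \forall u.\ \tau u \leftrightarrow f\,u = \mathsf{true}$; (b) $\exists u.\ \tau u$; (c) if $\tau u_2$ and $u_1$ is a prefix of $u_2$ then $\tau u_1$. It is infinite if $\forall n.\,\exists u.\ |u| \ge n \land \tau u$, and has an infinite path if $\exists f : \mathbb{N} \to \mathbb{B}.\ \forall n.\ \tau[f\,0, \dots, f\,n]$. $\mathsf{WKL}$ := every infinite decidable binary tree has an infinite path. -}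

module Defs where

open import Data.Bool.Base using (Bool; true; false)
open import Data.Empty using (⊥)
open import Data.List.Base using (List; length; applyUpTo)
open import Data.List.Relation.Binary.Prefix.Heterogeneous using (Prefix)
open import Data.Nat.Base using (ℕ; suc; _≥_)
open import Data.Product.Base using (∃; ∃-syntax; _×_; uncurry)
open import Data.Sum.Base using (_⊎_)
open import Function.Bundles using (_⇔_)
open import Relation.Binary.PropositionalEquality.Core using (_≡_)
open import Relation.Nullary.Negation.Core using (¬_)

-- With propositions as arbitrary types and "exists" as Σ, every choice
-- principle below would be provable.  So propositional existence is kept
-- abstract: ∥ A ∥ stands for the proposition "A is inhabited" (Coq's
-- inhabited A), which can be eliminated only into propositions.  No choice
-- principle for ∥_∥ is assumed, not even unique choice.  ¬∥⊥∥ holds in Coq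
-- because False may be eliminated into any type.
record Truncation : Set₁ where
  field
    ∥_∥   : Set → Set
    ∣_∣   : {A : Set} → A → ∥ A ∥
    elim  : {A B : Set} → (A → ∥ B ∥) → ∥ A ∥ → ∥ B ∥
    ¬∥⊥∥  : ¬ ∥ ⊥ ∥

module Principles (T : Truncation) where
  open Truncation T

  -- The universe ℙ: types into which ∥_∥ can be eliminated.  It contains ⊥,
  -- all decidable types and all ∥ A ∥, and is closed under Π, → and ×, so
  -- these connectives are Agda's own; only ∃ and ∨ need ∥_∥.
  record ℙ : Set₁ where
    field
      Prf    : Set
      stable : ∥ Prf ∥ → Prf
  open ℙ public

  infixr 1 _∨_
  _∨_ : Set → Set → Set
  A ∨ B = ∥ A ⊎ B ∥

  CoSemiDecidable : {X : Set} → (X → ℙ) → Set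
  CoSemiDecidable {X} p =
    ∥ (∃ λ (f : X → ℕ → Bool) → ∀ x → Prf (p x) ⇔ (∀ n → f x n ≡ false)) ∥

  CoSemiDecidable₂ : {X Y : Set} → (X → Y → ℙ) → Set
  CoSemiDecidable₂ R = CoSemiDecidable (uncurry R)

  LLPO : Set
  LLPO = (f g : ℕ → Bool) →
    (∥ (∃[ n ] f n ≡ true) ∥ → ∥ (∃[ n ] g n ≡ true) ∥) ∨
    (∥ (∃[ n ] g n ≡ true) ∥ → ∥ (∃[ n ] f n ≡ true) ∥)

  coS-AC-ℕ-Bool : Set₁
  coS-AC-ℕ-Bool = (R : ℕ → Bool → ℙ) → CoSemiDecidable₂ R →
    (∀ n → ∥ (∃[ b ] Prf (R n b)) ∥) →
    ∥ (∃ λ (f : ℕ → Bool) → ∀ n → Prf (R n (f n))) ∥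

  coS-¬¬AC-ℕ-Bool : Set₁
  coS-¬¬AC-ℕ-Bool = (R : ℕ → Bool → ℙ) → CoSemiDecidable₂ R →
    (∀ n → ¬ ¬ ∥ (∃[ b ] Prf (R n b)) ∥) →
    ∥ (∃ λ (f : ℕ → Bool) → ∀ n → Prf (R n (f n))) ∥

  -- applyUpTo f n is the list [ f 0 , … , f (n - 1) ].
  coS-¬¬DC-Bool : Set₁
  coS-¬¬DC-Bool = (R : List Bool → Bool → ℙ) → CoSemiDecidable₂ R →
    (∀ u → ¬ ¬ ∥ (∃[ b ] Prf (R u b)) ∥) →
    ∥ (∃ λ (f : ℕ → Bool) → ∀ n → Prf (R (applyUpTo f n) (f n))) ∥

  record IsBinaryTree (τ : List Bool → ℙ) : Set where
    field
      decidable     : ∥ (∃ λ (f : List Bool → Bool) →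
                           ∀ u → Prf (τ u) ⇔ (f u ≡ true)) ∥
      inhabited     : ∥ (∃[ u ] Prf (τ u)) ∥
      prefix-closed : ∀ {u₁ u₂} → Prf (τ u₂) → Prefix _≡_ u₁ u₂ → Prf (τ u₁)

  IsInfinite : (List Bool → ℙ) → Set
  IsInfinite τ = ∀ n → ∥ (∃[ u ] (length u ≥ n × Prf (τ u))) ∥

  HasInfinitePath : (List Bool → ℙ) → Set
  HasInfinitePath τ =
    ∥ (∃ λ (f : ℕ → Bool) → ∀ n → Prf (τ (applyUpTo f (suc n)))) ∥

  WKL : Set₁
  WKL = (τ : List Bool → ℙ) → IsBinaryTree τ → IsInfinite τ → HasInfinitePath τ

{-# OPTIONS --safe #-}

-- WKL ⇒ (4): the lists each of whose entries is compatible with R up to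
-- precision |u| form a decidable infinite tree, whose paths follow R exactly.
-- (4) ⇒ (3) ⇒ (2): forget the list up to its length; for LLPO, choose a side
-- that is not the only one to have been hit at any time.
-- (2) ⇒ WKL: LLPO shows that at each node u there is a child which at no height
-- is outlived by its sibling.  This is a co-semi-decidable condition on the
-- child, so choice (over lists coded as numbers) selects one for every u, and
-- walking from the root along the selected children never leaves the tree.
module Submission where

open import Data.Bool.Base using (Bool; true; false; not)
open import Data.Bool.Properties as Bool using (¬-not)
open import Data.List.Base using (List; []; _∷_; _∷ʳ_; _++_; length; applyUpTo)
open import Data.List.Properties
  using (++-identityʳ; length-applyUpTo; applyUpTo-∷ʳ; ∷ʳ-++)
open import Data.List.Relation.Binary.Prefix.Heterogeneous
  using (Prefix; []; _∷_)
open import Data.List.Relation.Binary.Prefix.Heterogeneous.Properties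
  using (length-mono)
open import Data.Nat.Base
  using (ℕ; zero; suc; _≤_; _<_; z≤n; s≤s; _⊔_)
open import Data.Nat.Binary.Base using (ℕᵇ; 2[1+_]; 1+[2_]; toℕ; fromℕ)
open import Data.Nat.Binary.Properties using (fromℕ-toℕ)
open import Data.Nat.Properties
  using (allUpTo?; anyUpTo?; ≤-reflexive; ≤-total; <-≤-trans; m≤m⊔n; m≤n⊔m)
open import Data.Product.Base using (∃; ∃-syntax; _×_; _,_; uncurry)
open import Data.Sum.Base using (_⊎_; inj₁; inj₂; [_,_]′)
open import Data.Unit.Base using (⊤; tt)
open import Function.Base using (_∘_)
open import Function.Bundles using (_⇔_; mk⇔; module Equivalence)
open import Relation.Binary.PropositionalEquality
  using (_≡_; refl; sym; trans; cong; subst)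
open import Relation.Nullary.Decidable
  using (Dec; yes; no; does; map′; _⊎-dec_; _×-dec_; _→-dec_; ¬?; decidable-stable;
         dec-true; dec-false)
open import Relation.Nullary.Negation using (¬_; contradiction)
open import Defs

open Equivalence using (to; from)

-- Decisions over booleans, and prefixes.

∃Bool? : {P : Bool → Set} → (∀ b → Dec (P b)) → Dec (∃ P)
∃Bool? P? = map′ [ (true ,_) , (false ,_) ]′
  (λ { (true , p) → inj₁ p ; (false , p) → inj₂ p })
  (P? true ⊎-dec P? false)

does-true⁻ : {A : Set} (a? : Dec A) → does a? ≡ true → A
does-true⁻ (yes a) _ = a

does-false⁻ : {A : Set} (a? : Dec A) → does a? ≡ false → ¬ A
does-false⁻ (no ¬a) _ = ¬a

prefix-∷ʳ : ∀ (u : List Bool) b → Prefix _≡_ u (u ∷ʳ b)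
prefix-∷ʳ []      b = []
prefix-∷ʳ (_ ∷ u) b = refl ∷ prefix-∷ʳ u b

-- Lists compatible with a relation.

-- Follows S u says that S (take i u) holds of the i-th entry of u, for all i.
Follows : (List Bool → Bool → Set) → List Bool → Set
Follows S []      = ⊤
Follows S (b ∷ u) = S [] b × Follows (S ∘ (b ∷_)) u

module _ where
  private variable S S′ : List Bool → Bool → Set

  follows? : (∀ u b → Dec (S u b)) → ∀ u → Dec (Follows S u)
  follows? S? []      = yes tt
  follows? S? (b ∷ u) = S? [] b ×-dec follows? (S? ∘ (b ∷_)) u

  follows-map : (∀ {u b} → S u b → S′ u b) → ∀ u → Follows S u → Follows S′ u
  follows-map i []      _       = tt
  follows-map i (b ∷ u) (s , r) = i s , follows-map i u r

  follows-prefix : ∀ {u v} → Prefix _≡_ u v → Follows S v → Follows S u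
  follows-prefix []         _       = tt
  follows-prefix (refl ∷ p) (s , r) = s , follows-prefix p r

  follows-total : (∀ u → ∃[ b ] S u b) → ∀ n → ∃[ u ] (length u ≡ n × Follows S u)
  follows-total total zero    = [] , refl , tt
  follows-total total (suc n) =
    let b , s     = total []
        u , l , r = follows-total (total ∘ (b ∷_)) n
    in b ∷ u , cong suc l , s , r

  follows-applyUpTo : ∀ f {n i} → i < n → Follows S (applyUpTo f n) →
                      S (applyUpTo f i) (f i)
  follows-applyUpTo f {suc n} {zero}  _         (s , _) = s
  follows-applyUpTo f {suc n} {suc i} (s≤s i<n) (_ , r) = follows-applyUpTo (f ∘ suc) i<n r

-- Nodes with descendants at a given depth.

-- Only the far end is tested: for prefix-closed `P` this still says that the subtree at `u` reaches
-- depth `n`, and binary branching makes it decidable.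
Extends : (List Bool → Set) → ℕ → List Bool → Set
Extends P zero    u = P u
Extends P (suc n) u = ∃[ b ] Extends P n (u ∷ʳ b)

module _ {P : List Bool → Set} where

  extends? : (∀ u → Dec (P u)) → ∀ n u → Dec (Extends P n u)
  extends? P? zero    u = P? u
  extends? P? (suc n) u = ∃Bool? λ b → extends? P? n (u ∷ʳ b)

  extends-++ : ∀ u v → P (u ++ v) → Extends P (length v) u
  extends-++ u []      p = subst P (++-identityʳ u) p
  extends-++ u (b ∷ v) p = b , extends-++ (u ∷ʳ b) v (subst P (sym (∷ʳ-++ u b v)) p)

  module _ (closed : ∀ u b → P (u ∷ʳ b) → P u) where

    extends⇒ : ∀ n {u} → Extends P n u → P u
    extends⇒ zero    p       = p
    extends⇒ (suc n) (b , e) = closed _ b (extends⇒ n e)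

    -- Cut the branch at depth `m`; closure carries `P` up from its end to the cut.
    extends-antitone : ∀ {m n} → m ≤ n → ∀ {u} → Extends P n u → Extends P m u
    extends-antitone {n = n} z≤n e       = extends⇒ n e
    extends-antitone (s≤s m≤n)   (b , e) = b , extends-antitone m≤n e

-- Walks along selected children.

walk : (List Bool → Bool) → ℕ → List Bool
walk c zero    = []
walk c (suc n) = walk c n ∷ʳ c (walk c n)

applyUpTo-walk : ∀ c n → applyUpTo (c ∘ walk c) n ≡ walk c n
applyUpTo-walk c zero    = refl
applyUpTo-walk c (suc n) = trans (sym (applyUpTo-∷ʳ (c ∘ walk c) n))
  (cong (_∷ʳ c (walk c n)) (applyUpTo-walk c n))

-- Coding boolean lists by numbers.

-- The constructors of ℕᵇ (bijective base 2) are those of List Bool.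
fromList : List Bool → ℕᵇ
fromList []          = ℕᵇ.zero
fromList (true ∷ u)  = 2[1+ fromList u ]
fromList (false ∷ u) = 1+[2 fromList u ]

toList : ℕᵇ → List Bool
toList ℕᵇ.zero   = []
toList 2[1+ x ] = true ∷ toList x
toList 1+[2 x ] = false ∷ toList x

toList-fromList : ∀ u → toList (fromList u) ≡ u
toList-fromList []          = refl
toList-fromList (true ∷ u)  = cong (true ∷_) (toList-fromList u)
toList-fromList (false ∷ u) = cong (false ∷_) (toList-fromList u)

encode : List Bool → ℕ
encode = toℕ ∘ fromList

decode : ℕ → List Bool
decode = toList ∘ fromℕ

decode-encode : ∀ u → decode (encode u) ≡ u
decode-encode u = trans (cong toList (fromℕ-toℕ (fromList u))) (toList-fromList u)

-- Truncation and decidable propositions.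

module _ (T : Truncation) where
  open Truncation T
  open Principles T

  ∥∥-map : {A B : Set} → (A → B) → ∥ A ∥ → ∥ B ∥
  ∥∥-map f = elim (∣_∣ ∘ f)

  ¬⇒¬∥∥ : {A : Set} → ¬ A → ¬ ∥ A ∥
  ¬⇒¬∥∥ ¬a = ¬∥⊥∥ ∘ ∥∥-map ¬a

  -- `∥ A ∥` refutes `¬ A`, and a decidable `A` follows from its double negation. This is how data
  -- leaves `∥_∥` below.
  dec⇒stable : {A : Set} → Dec A → ∥ A ∥ → A
  dec⇒stable a? x = decidable-stable a? λ ¬a → ¬⇒¬∥∥ ¬a x

  decℙ : {A : Set} → Dec A → ℙ
  decℙ {A} a? = record { Prf = A ; stable = dec⇒stable a? }

  Π₁ : {A : ℕ → Set} → (∀ n → Dec (A n)) → ℙ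
  Π₁ {A} A? = record
    { Prf    = ∀ n → A n
    ; stable = λ x n → dec⇒stable (A? n) (∥∥-map (λ a → a n) x)
    }

  Π₁-coSemiDecidable : {X Y : Set} {A : X → Y → ℕ → Set} (A? : ∀ x y n → Dec (A x y n)) →
                       CoSemiDecidable₂ (λ x y → Π₁ (A? x y))
  Π₁-coSemiDecidable A? = ∣ (λ (x , y) n → does (¬? (A? x y n))) , (λ (x , y) → mk⇔
    (λ a n → dec-false (¬? (A? x y n)) λ ¬a → ¬a (a n))
    (λ e n → decidable-stable (A? x y n) (does-false⁻ (¬? (A? x y n)) (e n)))) ∣

  -- From WKL to dependent choice.

  WKL⇒DC : WKL → coS-¬¬DC-Bool
  WKL⇒DC wkl R cosd total = elim fromWitness cosd
    where
    fromWitness : (∃ λ (F : List Bool × Bool → ℕ → Bool) →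
                     ∀ x → Prf (uncurry R x) ⇔ (∀ n → F x n ≡ false)) →
                  ∥ (∃ λ (f : ℕ → Bool) → ∀ n → Prf (R (applyUpTo f n) (f n))) ∥
    fromWitness (F , R⇔F) = ∥∥-map path⇒choice (wkl τ isTree infinite)
      where
      S : ℕ → List Bool → Bool → Set
      S m u b = ∀ {k} → k < m → F (u , b) k ≡ false

      S? : ∀ m u b → Dec (S m u b)
      S? m u b = allUpTo? (λ k → F (u , b) k Bool.≟ false) m

      τ? : ∀ u → Dec (Follows (S (length u)) u)
      τ? u = follows? (S? (length u)) u

      τ : List Bool → ℙ
      τ u = decℙ (τ? u)

      isTree : IsBinaryTree τ
      isTree = record
        { decidable     = ∣ does ∘ τ? , (λ u → mk⇔ (dec-true (τ? u)) (does-true⁻ (τ? u))) ∣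
        ; inhabited     = ∣ [] , tt ∣
        -- A shorter list is tested to a lower precision, so its conditions are weaker.
        ; prefix-closed = λ {u₁} r p → follows-map
            (λ s {_} k< → s (<-≤-trans k< (length-mono p))) u₁ (follows-prefix p r)
        }

      S-total : ∀ m u → ∃[ b ] S m u b
      S-total m u = decidable-stable (∃Bool? (S? m u)) λ ¬s →
        total u (¬⇒¬∥∥ λ (b , r) → ¬s (b , λ {k} _ → to (R⇔F (u , b)) r k))

      infinite : IsInfinite τ
      infinite n = let u , l , r = follows-total (S-total n) n in
        ∣ u , ≤-reflexive (sym l) , subst (λ m → Follows (S m) u) (sym l) r ∣

      path⇒choice : (∃ λ (f : ℕ → Bool) → ∀ n → Prf (τ (applyUpTo f (suc n)))) →
                    ∃ λ (f : ℕ → Bool) → ∀ n → Prf (R (applyUpTo f n) (f n))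
      -- The node of length `suc (n ⊔ k)` is long enough both to have an `n`-th entry and to be
      -- tested at stage `k`.
      path⇒choice (f , path) = f , λ n → from (R⇔F _) λ k →
        follows-applyUpTo {S = S (length (applyUpTo f (suc (n ⊔ k))))} f
          (s≤s (m≤m⊔n n k)) (path (n ⊔ k))
          (subst (k <_) (sym (length-applyUpTo f (suc (n ⊔ k)))) (s≤s (m≤n⊔m n k)))

  -- From dependent choice to countable choice and LLPO.

  DC⇒¬¬AC : coS-¬¬DC-Bool → coS-¬¬AC-ℕ-Bool
  DC⇒¬¬AC dc R cosd total =
    ∥∥-map (λ (f , r) → f , λ n → subst (λ m → Prf (R m (f n))) (length-applyUpTo f n) (r n))
      (dc (R ∘ length)
          (∥∥-map (λ (F , R⇔F) → (λ (u , b) → F (length u , b)) ,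
                                 (λ (u , b) → R⇔F (length u , b))) cosd)
          (total ∘ length))

  ¬¬AC⇒AC : coS-¬¬AC-ℕ-Bool → coS-AC-ℕ-Bool
  ¬¬AC⇒AC ac R cosd total = ac R cosd λ n ¬r → ¬r (total n)

  ¬¬AC⇒LLPO : coS-¬¬AC-ℕ-Bool → LLPO
  ¬¬AC⇒LLPO ac f g =
    ∥∥-map (λ (e , r) → decide (e 0) (r 0))
      -- The relation is constant in its index: choice only serves to turn one doubly negated
      -- existence into a boolean `e 0`.
      (ac (λ _ b → Π₁ (A? b)) (Π₁-coSemiDecidable (λ _ → A?)) λ _ ¬r → refute (¬r ∘ ∣_∣))
    where
    -- The bound includes `n` itself: otherwise a simultaneous first hit of `f` and `g` would defeat
    -- both sides.
    Hit : (ℕ → Bool) → ℕ → Set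
    Hit h n = ∃[ k ] (k < suc n × h k ≡ true)

    hit? : ∀ h n → Dec (Hit h n)
    hit? h n = anyUpTo? (λ k → h k Bool.≟ true) (suc n)

    side : Bool → ℕ → Bool
    side true  = f
    side false = g

    A : Bool → ℕ → Set
    A b n = side b n ≡ true → Hit (side (not b)) n

    A? : ∀ b n → Dec (A b n)
    A? b n = (side b n Bool.≟ true) →-dec hit? (side (not b)) n

    -- If `true` fails at `n`, then `f` hits at `n` while `g` has no hit up to `n`. Every hit of `g`
    -- thus comes later and is matched by `n`, so `false` succeeds.
    refute : ¬ ¬ (∃[ b ] (∀ n → A b n))
    refute ¬a = ¬a (true , λ n fn → decidable-stable (hit? g n) λ ¬hit →
      ¬a (false , λ m gm → [ (λ n≤m → n , s≤s n≤m , fn)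
                           , (λ m≤n → contradiction (m , s≤s m≤n , gm) ¬hit)
                           ]′ (≤-total n m)))

    Impl : (ℕ → Bool) → (ℕ → Bool) → Set
    Impl h k = ∥ (∃[ n ] h n ≡ true) ∥ → ∥ (∃[ n ] k n ≡ true) ∥

    decide : ∀ b → (∀ n → A b n) → Impl f g ⊎ Impl g f
    decide true  a = inj₁ (∥∥-map λ (n , e) → let k , _ , e′ = a n e in k , e′)
    decide false a = inj₂ (∥∥-map λ (n , e) → let k , _ , e′ = a n e in k , e′)

  -- From LLPO and countable choice to WKL.

  AC-List : coS-AC-ℕ-Bool → (R : List Bool → Bool → ℙ) → CoSemiDecidable₂ R →
            (∀ u → ∥ (∃[ b ] Prf (R u b)) ∥) →
            ∥ (∃ λ (c : List Bool → Bool) → ∀ u → Prf (R u (c u))) ∥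
  AC-List ac R cosd total =
    ∥∥-map (λ (f , r) → f ∘ encode , λ u →
              subst (λ v → Prf (R v (f (encode u)))) (decode-encode u) (r (encode u)))
      (ac (R ∘ decode)
          (∥∥-map (λ (F , R⇔F) → (λ (n , b) → F (decode n , b)) ,
                                 (λ (n , b) → R⇔F (decode n , b))) cosd)
          (total ∘ decode))

  -- Either implication given by LLPO would turn a witness of one predicate into a witness of the
  -- other, against disjointness.
  LLPO-disjoint : LLPO → {A B : ℕ → Set} → (∀ n → Dec (A n)) → (∀ n → Dec (B n)) →
                  (∀ m n → A m → ¬ B n) → (∀ n → ¬ A n) ∨ (∀ n → ¬ B n)
  LLPO-disjoint llpo {A} {B} A? B? disjoint =
    ∥∥-map [ (λ i → inj₁ λ n a → ¬⇒¬∥∥ (λ (m , e) → disjoint n m a (does-true⁻ (B? m) e))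
                                       (i ∣ n , dec-true (A? n) a ∣))
           , (λ i → inj₂ λ n b → ¬⇒¬∥∥ (λ (m , e) → disjoint m n (does-true⁻ (A? m) e) b)
                                       (i ∣ n , dec-true (B? n) b ∣))
           ]′ (llpo (does ∘ A?) (does ∘ B?))

  LLPO×AC⇒WKL : LLPO → coS-AC-ℕ-Bool → WKL
  LLPO×AC⇒WKL llpo ac τ isTree infinite = elim fromDecider (IsBinaryTree.decidable isTree)
    where
    P : List Bool → Set
    P u = Prf (τ u)

    closed : ∀ u b → P (u ∷ʳ b) → P u
    closed u b p = IsBinaryTree.prefix-closed isTree p (prefix-∷ʳ u b)

    fromDecider : (∃ λ (t : List Bool → Bool) → ∀ u → P u ⇔ (t u ≡ true)) →
                  HasInfinitePath τ
    fromDecider (t , P⇔t) = ∥∥-map choice⇒path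
      (AC-List ac (λ u b → Π₁ (survives? u b)) (Π₁-coSemiDecidable survives?) survivor)
      where
      P? : ∀ u → Dec (P u)
      P? u = map′ (from (P⇔t u)) (to (P⇔t u)) (t u Bool.≟ true)

      ext? : ∀ u n b → Dec (Extends P n (u ∷ʳ b))
      ext? u n b = extends? P? n (u ∷ʳ b)

      Survives : List Bool → Bool → ℕ → Set
      Survives u b n = Extends P n (u ∷ʳ not b) → Extends P n (u ∷ʳ b)

      survives? : ∀ u b n → Dec (Survives u b n)
      survives? u b n = ext? u n (not b) →-dec ext? u n b

      Outlived : List Bool → Bool → ℕ → Set
      Outlived u b n = Extends P n (u ∷ʳ not b) × ¬ Extends P n (u ∷ʳ b)

      outlived? : ∀ u b n → Dec (Outlived u b n)
      outlived? u b n = ext? u n (not b) ×-dec ¬? (ext? u n b)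

      -- At the smaller of the two depths one child has no extension, yet its extension at the
      -- larger depth can be cut down to one.
      disjoint : ∀ u m n → Outlived u true m → ¬ Outlived u false n
      disjoint u m n (e , ¬e) (e′ , ¬e′) =
        [ (λ m≤n → ¬e (extends-antitone closed m≤n e′))
        , (λ n≤m → ¬e′ (extends-antitone closed n≤m e))
        ]′ (≤-total m n)

      ¬outlived : ∀ u b n → ¬ Outlived u b n → Survives u b n
      ¬outlived u b n ¬o e = decidable-stable (ext? u n b) λ ¬e → ¬o (e , ¬e)

      survivor : ∀ u → ∥ (∃[ b ] (∀ n → Survives u b n)) ∥
      survivor u =
        ∥∥-map [ (λ ¬o → true , λ n → ¬outlived u true n (¬o n))
               , (λ ¬o → false , λ n → ¬outlived u false n (¬o n))
               ]′ (LLPO-disjoint llpo (outlived? u true) (outlived? u false) (disjoint u))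

      choice⇒path : (∃ λ (c : List Bool → Bool) → ∀ u n → Survives u (c u) n) →
                    ∃ λ (f : ℕ → Bool) → ∀ n → P (applyUpTo f (suc n))
      choice⇒path (c , survives) =
        c ∘ walk c , λ n → subst P (sym (applyUpTo-walk c (suc n))) (unbounded (suc n) 0)
        where
        unbounded : ∀ k n → Extends P n (walk c k)
        -- A node of length at least `n` is cut to depth exactly `n`, which makes the claim
        -- decidable and frees it from `∥_∥`.
        unbounded zero    n = dec⇒stable (extends? P? n [])
          (∥∥-map (λ (u , l , p) → extends-antitone closed l (extends-++ [] u p)) (infinite n))
        -- One more level is requested since the step to a child uses one up. If the branch goes
        -- through the sibling of the selected child, `survives` transfers its depth.
        unbounded (suc k) n with unbounded k (suc n)
        ... | b , e with b Bool.≟ c (walk c k)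
        ...   | yes refl = e
        ...   | no b≢c   = survives (walk c k) n
          (subst (λ d → Extends P n (walk c k ∷ʳ d)) (¬-not b≢c) e)

theorem57 : (T : Truncation) → let open Principles T in
    (WKL ⇔ (LLPO × coS-AC-ℕ-Bool)) ×
    (WKL ⇔ coS-¬¬AC-ℕ-Bool) ×
    (WKL ⇔ coS-¬¬DC-Bool)
theorem57 T =
  mk⇔ (¬¬AC⇒2 ∘ WKL⇒¬¬AC) 2⇒WKL ,
  mk⇔ WKL⇒¬¬AC ¬¬AC⇒WKL ,
  mk⇔ (WKL⇒DC T) (¬¬AC⇒WKL ∘ DC⇒¬¬AC T)
  where
  open Principles T

  WKL⇒¬¬AC : WKL → coS-¬¬AC-ℕ-Bool
  WKL⇒¬¬AC = DC⇒¬¬AC T ∘ WKL⇒DC T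

  ¬¬AC⇒2 : coS-¬¬AC-ℕ-Bool → LLPO × coS-AC-ℕ-Bool
  ¬¬AC⇒2 ac = ¬¬AC⇒LLPO T ac , ¬¬AC⇒AC T ac

  2⇒WKL : LLPO × coS-AC-ℕ-Bool → WKL
  2⇒WKL = uncurry (LLPO×AC⇒WKL T)

  ¬¬AC⇒WKL : coS-¬¬AC-ℕ-Bool → WKL
  ¬¬AC⇒WKL = 2⇒WKL ∘ ¬¬AC⇒2
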